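{- Let $A\in\mathbb{R}_{\max}^{p\times n}$, $B\in\mathbb{G}^{p\times n}$, $\mathbf{c}\in\mathbb{R}_{\max}^p$, $\mathbf{d}\in\mathbb{G}^p$, $g\in\mathbb{R}_{\max}$, $h\in\mathbb{G}\setminus\{+\infty\}$, and let $\mathbf{e}$ and $\mathbf{f}$ be $n$-dimensional row vectors with entries in $\mathbb{R}_{\max}$ and $\mathbb{G}$ respectively, such that $(\mathbf{e},g)$ is not identically $-\infty$. Let $\mathbf{v}=(\mathbf{e},g,\mathbf{f},h)$, a row vector of dimension $2n+2$, and let $R\in\mathbb{G}^{p\times(2n+2)}$ be the matrix whose $i$-th row is $(A_i,\mathbf{c}_i,B_i,\mathbf{d}_i)$, where $A_i,B_i$ are the $i$-th rows of $A,B$; assume that no row of $R$ is identically $-\infty$. Define the $p$-dimensional row vector $\mathbf{w}^*$ by $$\mathbf{w}^*_i=\min_{1\leq j\leq 2n+2}(\mathbf{v}_j/R_{ij}),\qquad 1\le i\le p .$$ Then the inequality $\mathbf{e}\mathbf{x}\oplus g\leq_{\mathbb{G}}\mathbf{f}\mathbf{x}\oplus h$ is a linear combination of the inequalities in the system $A\mathbf{x}\oplus\mathbf{c}\leq_{\mathbb{G}}B\mathbf{x}\oplus\mathbf{d}$ if, and only if, $\mathbf{v}=\mathbf{w}^*R$.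
   Context: $\mathbb{R}_{\max}=\mathbb{R}\cup\{ -\infty\}$ is the max-plus semiring ($x\oplus y=\max(x,y)$, $x\otimes y=xy=x+y$), and $\overline{\mathbb{R}}_{\max}=\mathbb{R}_{\max}\cup\{+\infty\}$. Let $\mathbb{R}^-=\{\alpha^-:\alpha\in\mathbb{R}\}$ be a disjoint copy of $\mathbb{R}$ and $\mathbb{G}=\overline{\mathbb{R}}_{\max}\cup\mathbb{R}^-$. The modulus is $|x|=x$ for $x\in\overline{\mathbb{R}}_{\max}$ and $|\alpha^-|=\alpha$. The total order $\leq_{\mathbb{G}}$ is: $x\leq_{\mathbb{G}}y$ iff $|x|<|y|$ when $x\in\overline{\mathbb{R}}_{\max}$ and $y\in\mathbb{R}^-$, and $|x|\le|y|$ in all other cases. $\mathbb{G}$ is a semiring where $x\oplus y$ is the greater of $x,y$ for $\leq_{\mathbb{G}}$, and $xy$ is: $x+y$ if $x,y\in\mathbb{R}$; $(|x|+|y|)^-$ if $x\in\mathbb{R}^-$ or $y\in\mathbb{R}^-$ and both are different from $\pm\infty$; $-\infty$ if $x=-\infty$ or $y=-\infty$; $+\infty$ if neither is $-\infty$ and at least one is $+\infty$. Matrix operations use these operations. For $x,y\in\mathbb{G}$, $y/x$ denotes the maximal element of $\{z\in\mathbb{G}: zx\leq_{\mathbb{G}}y\}$; explicitly $y/x=(|y|-|x|)^-$ if $x\in\mathbb{R}$ and $y\in\mathbb{R}^-$, and $y/x=|y|-|x|$ otherwise, with the conventions $\alpha-(-\infty)=+\infty$ for $\alpha\in\overline{\mathbb{R}}_{\max}$,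 $\alpha-(+\infty)=-\infty$ for $\alpha\in\mathbb{R}_{\max}$, and $(+\infty)-(+\infty)=+\infty$. The minimum is taken with respect to $\leq_{\mathbb{G}}$. The inequality represented by $\mathbf{v}$ is a linear combination of the inequalities of the system if there exists a $p$-dimensional row vector $\mathbf{w}$ with entries in $\mathbb{G}$ such that $\mathbf{v}=\mathbf{w}R$. -}

module Defs where

open import Level using (Level; _⊔_; suc)
open import Algebra.Core using (Op₁; Op₂)
import Algebra.Definitions
import Algebra.Structures
open import Data.Bool.Base using (if_then_else_)
open import Data.Nat.Base using (ℕ; _+_)
open import Data.Product.Base using (∃; _×_)
open import Data.Vec.Functional using (Vector; foldr; map; _++_; []; _∷_)
open import Relation.Binary.Core using (Rel)
open import Relation.Binary.Definitions using (Decidable)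
open import Relation.Binary.Structures using (IsDecTotalOrder)
import Relation.Binary.Construct.NonStrictToStrict as ToStrict
import Relation.Binary.Construct.Add.Extrema.Equality as ±Equality
import Relation.Binary.Construct.Add.Extrema.NonStrict as ±NonStrict
import Relation.Binary.Construct.Add.Extrema.Strict as ±Strict
open import Relation.Nullary.Negation using (¬_)
open import Relation.Nullary.Decidable.Core using (does; map′)
open import Relation.Nullary.Construct.Add.Infimum using (_₋; ⊥₋)
import Relation.Nullary.Construct.Add.Supremum as Supremum
open import Relation.Nullary.Construct.Add.Extrema using (_±; ⊥±; ⊤±; [_])
open import Relation.Unary using (Pred; Satisfiable)

-- The real numbers, given by the axioms that characterise them up to
-- isomorphism: a Dedekind-complete totally ordered field.  As in classical
-- mathematics, the order is decidable.

record Reals c ℓ₁ ℓ₂ : Set (suc (c ⊔ ℓ₁ ⊔ ℓ₂)) where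
  infix  8 -_
  infixl 7 _*_
  infixl 6 _+ᴿ_
  infix  4 _≈_ _≤_
  field
    Carrier : Set c
    _≈_     : Rel Carrier ℓ₁
    _≤_     : Rel Carrier ℓ₂
    _+ᴿ_    : Op₂ Carrier
    _*_     : Op₂ Carrier
    -_      : Op₁ Carrier
    0#      : Carrier
    1#      : Carrier

  open Algebra.Definitions _≈_ using (Invertible)
  open Algebra.Structures _≈_ using (IsCommutativeRing)

  UpperBound : ∀ {p} → Pred Carrier p → Pred Carrier (c ⊔ ℓ₂ ⊔ p)
  UpperBound P u = ∀ {x} → P x → x ≤ u

  field
    isCommutativeRing : IsCommutativeRing _+ᴿ_ _*_ -_ 0# 1#
    0≉1               : ¬ (0# ≈ 1#)
    ≉0⇒invertible     : ∀ {x} → ¬ (x ≈ 0#) → Invertible 1# _*_ x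
    isDecTotalOrder   : IsDecTotalOrder _≈_ _≤_
    +-monoʳ-≤         : ∀ x {y z} → y ≤ z → x +ᴿ y ≤ x +ᴿ z
    *-nonNeg          : ∀ {x y} → 0# ≤ x → 0# ≤ y → 0# ≤ x * y
    complete          : (P : Pred Carrier (c ⊔ ℓ₁ ⊔ ℓ₂)) →
                        Satisfiable P → ∃ (UpperBound P) →
                        ∃ λ s → UpperBound P s ×
                                (∀ {u} → UpperBound P u → s ≤ u)

-- A ₋ and A ± (from the library) are A ∪ {-∞} and A ∪ {-∞, +∞}.

data WithMinus {a} (A : Set a) : Set a where
  ⟨_⟩ : A ± → WithMinus A
  _⁻  : A   → WithMinus A

pattern -∞    = ⟨ ⊥± ⟩
pattern +∞    = ⟨ ⊤± ⟩
pattern fin α = ⟨ [ α ] ⟩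

module MaxPlus {c ℓ₁ ℓ₂} (Real : Reals c ℓ₁ ℓ₂) where

  open Reals Real using (_≈_; _≤_; _+ᴿ_; -_; isDecTotalOrder)
    renaming (Carrier to ℝ) public
  open IsDecTotalOrder isDecTotalOrder using (_≟_; _≤?_)
  open ToStrict _≈_ _≤_ using (_<_; <-decidable)
  open ±Equality _≈_ using (_≈±_)
  open ±NonStrict _≤_ using (_≤±_; ≤±-dec)
  open ±Strict _<_ using (_<±_; <±-dec)

  infix  8 ∣_∣
  infixl 7 _⊗_ _/_
  infixl 6 _⊕_ _-±_
  infix  6 _⊓_
  infix  4 _≈ᴳ_ _≤ᴳ_ _≤ᴳ?_ _≋_

  ℝmax ℝ̅max 𝔾 : Set c
  ℝmax = ℝ ₋
  ℝ̅max = ℝ ±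
  𝔾    = WithMinus ℝ

  ι : ℝmax → 𝔾
  ι x = ⟨ Supremum.[ x ] ⟩

  data _≈ᴳ_ : Rel 𝔾 (c ⊔ ℓ₁) where
    ⟨_⟩ : ∀ {x y} → x ≈± y → ⟨ x ⟩ ≈ᴳ ⟨ y ⟩
    _⁻  : ∀ {α β} → α ≈ β  → α ⁻   ≈ᴳ β ⁻

  ∣_∣ : 𝔾 → ℝ̅max
  ∣ ⟨ x ⟩ ∣ = x
  ∣ α ⁻   ∣ = [ α ]

  -- Strict comparison of moduli exactly when x ∈ ℝ̅max and y ∈ ℝ⁻, so that
  -- α ⁻ lies immediately below α.
  data _≤ᴳ_ : Rel 𝔾 (c ⊔ ℓ₁ ⊔ ℓ₂) where
    ⟨⟩≤⁻  : ∀ {x β} → x <± [ β ]         → ⟨ x ⟩ ≤ᴳ β ⁻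
    ⟨⟩≤⟨⟩ : ∀ {x y} → x ≤± y             → ⟨ x ⟩ ≤ᴳ ⟨ y ⟩
    ⁻≤    : ∀ {α y} → [ α ] ≤± ∣ y ∣     → α ⁻   ≤ᴳ y

  _≤ᴳ?_ : Decidable _≤ᴳ_
  ⟨ x ⟩ ≤ᴳ? ⟨ y ⟩ = map′ ⟨⟩≤⟨⟩ (λ { (⟨⟩≤⟨⟩ p) → p }) (≤±-dec _≤?_ x y)
  ⟨ x ⟩ ≤ᴳ? β ⁻   =
    map′ ⟨⟩≤⁻ (λ { (⟨⟩≤⁻ p) → p }) (<±-dec (<-decidable _≟_ _≤?_) x [ β ])
  α ⁻   ≤ᴳ? y     = map′ ⁻≤ (λ { (⁻≤ p) → p }) (≤±-dec _≤?_ [ α ] ∣ y ∣)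

  _⊕_ : Op₂ 𝔾
  x ⊕ y = if does (x ≤ᴳ? y) then y else x

  _⊓_ : Op₂ 𝔾
  x ⊓ y = if does (x ≤ᴳ? y) then x else y

  _⊗_ : Op₂ 𝔾
  -∞    ⊗ _     = -∞
  _     ⊗ -∞    = -∞
  +∞    ⊗ _     = +∞
  _     ⊗ +∞    = +∞
  fin α ⊗ fin β = fin (α +ᴿ β)
  fin α ⊗ β ⁻   = (α +ᴿ β) ⁻
  α ⁻   ⊗ fin β = (α +ᴿ β) ⁻
  α ⁻   ⊗ β ⁻   = (α +ᴿ β) ⁻

  _-±_ : Op₂ ℝ̅max
  _     -± ⊥±    = ⊤±
  ⊤±    -± ⊤±    = ⊤±
  _     -± ⊤±    = ⊥±
  ⊥±    -± [ _ ] = ⊥±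
  ⊤±    -± [ _ ] = ⊤±
  [ α ] -± [ β ] = [ α +ᴿ - β ]

  -- The residual: y / x is the greatest z with z ⊗ x ≤ᴳ y.
  _/_ : Op₂ 𝔾
  β ⁻ / fin α = (β +ᴿ - α) ⁻
  y   / x     = ⟨ ∣ y ∣ -± ∣ x ∣ ⟩

  -- -∞ and +∞ are the least and greatest elements for _≤ᴳ_, hence neutral
  -- for _⊕_ and _⊓_ respectively.
  ⨁ : ∀ {n} → Vector 𝔾 n → 𝔾
  ⨁ = foldr _⊕_ -∞

  minimum : ∀ {n} → Vector 𝔾 n → 𝔾
  minimum = foldr _⊓_ +∞

  Matrix : ∀ {a} → Set a → ℕ → ℕ → Set a
  Matrix A m n = Vector (Vector A n) m

  _≋_ : ∀ {n} → Rel (Vector 𝔾 n) (c ⊔ ℓ₁)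
  x ≋ y = ∀ j → x j ≈ᴳ y j

  _∙ᵣ_ : ∀ {m n} → Vector 𝔾 m → Matrix 𝔾 m n → Vector 𝔾 n
  (w ∙ᵣ M) j = ⨁ λ i → w i ⊗ M i j

  -- The inequality  a x ⊕ c ≤ᴳ b x ⊕ d  in x, as its data (a , c , b , d).
  record Inequality (n : ℕ) : Set c where
    constructor _∙x⊕_≤_∙x⊕_
    field
      lhsCoeffs : Vector ℝmax n
      lhsConst  : ℝmax
      rhsCoeffs : Vector 𝔾 n
      rhsConst  : 𝔾

    lhs : Vector ℝmax (n + 1)
    lhs = lhsCoeffs ++ (lhsConst ∷ [])

    rhs : Vector 𝔾 (n + 1)
    rhs = rhsCoeffs ++ (rhsConst ∷ [])

    -- The row vector of dimension 2n + 2 representing the inequality.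
    row : Vector 𝔾 ((n + 1) + (n + 1))
    row = map ι lhs ++ rhs

  open Inequality public using (lhs; rhs; row)

  System : ℕ → ℕ → Set c
  System p n = Vector (Inequality n) p

  system : ∀ {p n} → Matrix ℝmax p n → Vector ℝmax p →
           Matrix 𝔾 p n → Vector 𝔾 p → System p n
  system A c B d i = A i ∙x⊕ c i ≤ B i ∙x⊕ d i

  rows : ∀ {p n} → System p n → Matrix 𝔾 p ((n + 1) + (n + 1))
  rows S i = row (S i)

  _IsLinearCombinationOf_ : ∀ {p n} → Inequality n → System p n → Set (c ⊔ ℓ₁)
  _IsLinearCombinationOf_ {p} I S = ∃ λ (w : Vector 𝔾 p) → row I ≋ (w ∙ᵣ rows S)

  w* : ∀ {p m} → Vector 𝔾 m → Matrix 𝔾 p m → Vector 𝔾 p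
  w* v M i = minimum λ j → v j / M i j

{-# OPTIONS --safe #-}
module Submission where

-- Residuation: z ⊗ x ≤ᴳ y exactly when z ≤ᴳ y / x.  Hence w* v R is the greatest
-- row vector w with w R ≤ᴳ v, so that v = w R forces v = w R ≤ᴳ (w* v R) R ≤ᴳ v.

open import Defs
open import Algebra.Bundles using (Group)
open import Algebra.Construct.NaturalChoice.Base using (MaxOperator; MinOperator)
import Algebra.Construct.NaturalChoice.MaxOp as MaxOp
import Algebra.Construct.NaturalChoice.MinOp as MinOp
import Algebra.Properties.Group as GroupProperties
import Algebra.Structures
open import Data.Nat.Base using (ℕ)
open import Data.Fin.Base using (zero; suc)
open import Data.Product.Base using (_,_)
open import Data.Sum.Base using (inj₁; inj₂) renaming (map to map-⊎)
open import Data.Vec.Functional using (Vector)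
open import Function.Base using (_∘_)
open import Function.Bundles using (_⇔_; mk⇔)
open import Level using (_⊔_)
open import Relation.Binary.Bundles using (TotalOrder)
import Relation.Binary.Construct.Add.Extrema.Equality as ±Equality
import Relation.Binary.Construct.Add.Extrema.NonStrict as ±NonStrict
import Relation.Binary.Construct.Add.Extrema.Strict as ±Strict
import Relation.Binary.Construct.NonStrictToStrict as ToStrict
import Relation.Binary.Construct.Add.Supremum.NonStrict as Supremum≤
open import Relation.Binary.Definitions
  using (Antisymmetric; Maximum; Minimum; Symmetric; Total; Trans; Transitive)
open import Relation.Binary.PropositionalEquality using (_≡_; _≢_)
open import Relation.Binary.Structures using (IsDecTotalOrder; IsTotalOrder)
open import Relation.Nullary using (¬_; yes; no; contradiction)
open import Relation.Nullary.Construct.Add.Extrema using ([_])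
open import Relation.Nullary.Construct.Add.Infimum using (⊥₋)
import Relation.Nullary.Construct.Add.Supremum as Supremum

-- The map sending `w` to `w ∙ᵣ R` has an upper adjoint. By `⊗≤⇒≤/` and `≤/⇒⊗≤`, multiplication by a
-- fixed entry is adjoint to division by it. A sum lies below a bound iff each term does, and an
-- element lies below a minimum iff it lies below each entry, so `w ∙ᵣ R` is entrywise below `v` iff
-- `w` is entrywise below `w* v R`. Any solution `w` of v = wR is therefore below `w*`, and v = wR ≤
-- w*R ≤ v by monotonicity. Conversely, `w*` is itself a witness. The real work is the scalar
-- adjunction, which reduces by cases to moving a term across an inequality of reals.

module _ {c ℓ₁ ℓ₂} (Real : Reals c ℓ₁ ℓ₂) where

  open MaxPlus Real
  open Reals Real using (isCommutativeRing; +-monoʳ-≤)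
  open Algebra.Structures _≈_ using (module IsCommutativeRing)
  open IsCommutativeRing isCommutativeRing using (+-comm; +-congʳ; +-isGroup)
  open IsDecTotalOrder isDecTotalOrder
    using (_≤?_; module Eq; reflexive; trans; antisym; total;
           ≤-respˡ-≈; ≤-respʳ-≈)
  open ToStrict _≈_ _≤_ using (_<_; ≰⇒>; <-irrefl; <-≤-trans; ≤-<-trans; <⇒≤)
  open ±Equality _≈_ using (≈±-refl; ≈±-sym; ≈±-trans)
  open ±NonStrict _≤_
    using (_≤±_; [≤]-injective; ⊥±≤_; _≤⊤±; ≤±-trans; ≤±-total; ≤±-reflexive; ≤±-antisym)
  open ±Strict _<_ using (_<±_; <±-transˡ; <±-transʳ; <±-irrefl)

  -- Moving terms across inequalities in ℝ

  +-group : Group c ℓ₁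
  +-group = record { isGroup = +-isGroup }

  open GroupProperties +-group using (x≈z//y; //-rightDividesˡ; //-rightDividesʳ)

  +-monoˡ-≤ : ∀ γ {α β} → α ≤ β → α +ᴿ γ ≤ β +ᴿ γ
  +-monoˡ-≤ γ α≤β =
    ≤-respˡ-≈ (+-comm γ _) (≤-respʳ-≈ (+-comm γ _) (+-monoʳ-≤ γ α≤β))

  +≤⇒≤- : ∀ {α β γ} → γ +ᴿ α ≤ β → γ ≤ β +ᴿ - α
  +≤⇒≤- {α} {γ = γ} p = ≤-respˡ-≈ (//-rightDividesʳ α γ) (+-monoˡ-≤ (- α) p)

  ≤-⇒+≤ : ∀ {α β γ} → γ ≤ β +ᴿ - α → γ +ᴿ α ≤ β
  ≤-⇒+≤ {α} {β} p = ≤-respʳ-≈ (//-rightDividesˡ α β) (+-monoˡ-≤ α p)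

  -- The strict versions serve the comparison of an unsigned product with an element of ℝ⁻.
  +<⇒<- : ∀ {α β γ} → γ +ᴿ α < β → γ < β +ᴿ - α
  +<⇒<- {α} {β} (γ+α≤β , γ+α≉β) =
    +≤⇒≤- γ+α≤β , λ γ≈ → γ+α≉β (Eq.trans (+-congʳ γ≈) (//-rightDividesˡ α β))

  <-⇒+< : ∀ {α β γ} → γ < β +ᴿ - α → γ +ᴿ α < β
  <-⇒+< (γ≤ , γ≉) = ≤-⇒+≤ γ≤ , γ≉ ∘ x≈z//y _ _ _

  -- The total order on 𝔾

  ≤±-<±-trans : Trans _≤±_ _<±_ _<±_
  ≤±-<±-trans = <±-transʳ (≤-<-trans trans antisym ≤-respˡ-≈)

  <±-≤±-trans : Trans _<±_ _≤±_ _<±_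
  <±-≤±-trans = <±-transˡ (<-≤-trans Eq.sym trans antisym ≤-respʳ-≈)

  <±⇒≤± : ∀ {x y} → x <± y → x ≤± y
  <±⇒≤± ±Strict.⊥±<[ _ ] = ⊥±≤ _
  <±⇒≤± ±Strict.[ p ]    = ±NonStrict.[ <⇒≤ p ]
  <±⇒≤± ±Strict.⊥±<⊤±    = ⊥±≤ _
  <±⇒≤± ±Strict.[ _ ]<⊤± = _ ≤⊤±

  ∣∣-mono : ∀ {x y} → x ≤ᴳ y → ∣ x ∣ ≤± ∣ y ∣
  ∣∣-mono (⟨⟩≤⁻ p)  = <±⇒≤± p
  ∣∣-mono (⟨⟩≤⟨⟩ p) = p
  ∣∣-mono (⁻≤ p)    = p

  -- Strictness must survive only from an unsigned left end to a right end in ℝ⁻. When the left end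
  -- is in ℝ⁻, comparing moduli is enough.
  ≤ᴳ-trans : Transitive _≤ᴳ_
  ≤ᴳ-trans (⟨⟩≤⁻ p)  (⁻≤ {y = ⟨ _ ⟩} q) = ⟨⟩≤⟨⟩ (≤±-trans trans (<±⇒≤± p) q)
  ≤ᴳ-trans (⟨⟩≤⁻ p)  (⁻≤ {y = _ ⁻} q)   = ⟨⟩≤⁻ (<±-≤±-trans p q)
  ≤ᴳ-trans (⟨⟩≤⟨⟩ p) (⟨⟩≤⁻ q)           = ⟨⟩≤⁻ (≤±-<±-trans p q)
  ≤ᴳ-trans (⟨⟩≤⟨⟩ p) (⟨⟩≤⟨⟩ q)          = ⟨⟩≤⟨⟩ (≤±-trans trans p q)
  ≤ᴳ-trans (⁻≤ p)    y≤z                = ⁻≤ (≤±-trans trans p (∣∣-mono y≤z))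

  ≤ᴳ-antisym : Antisymmetric _≈ᴳ_ _≤ᴳ_
  ≤ᴳ-antisym (⟨⟩≤⟨⟩ p) (⟨⟩≤⟨⟩ q) = ⟨ ≤±-antisym antisym p q ⟩
  -- Mixed elements comparable both ways would have a modulus strictly below itself.
  ≤ᴳ-antisym (⟨⟩≤⁻ p)  (⁻≤ q)    =
    contradiction (<±-≤±-trans p q) (<±-irrefl <-irrefl (≈±-refl Eq.refl))
  ≤ᴳ-antisym (⁻≤ p)    (⟨⟩≤⁻ q)  =
    contradiction (<±-≤±-trans q p) (<±-irrefl <-irrefl (≈±-refl Eq.refl))
  ≤ᴳ-antisym (⁻≤ p)    (⁻≤ q)    = antisym ([≤]-injective p) ([≤]-injective q) ⁻

  ≤ᴳ-reflexive : ∀ {x y} → x ≈ᴳ y → x ≤ᴳ y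
  ≤ᴳ-reflexive ⟨ p ⟩ = ⟨⟩≤⟨⟩ (≤±-reflexive reflexive p)
  ≤ᴳ-reflexive (p ⁻) = ⁻≤ ±NonStrict.[ reflexive p ]

  ≤ᴳ-minimum : Minimum _≤ᴳ_ -∞
  ≤ᴳ-minimum ⟨ y ⟩ = ⟨⟩≤⟨⟩ (⊥±≤ y)
  ≤ᴳ-minimum (β ⁻) = ⟨⟩≤⁻ ±Strict.⊥±<[ β ]

  ≤ᴳ-maximum : Maximum _≤ᴳ_ +∞
  ≤ᴳ-maximum ⟨ x ⟩ = ⟨⟩≤⟨⟩ (x ≤⊤±)
  ≤ᴳ-maximum (α ⁻) = ⁻≤ ([ α ] ≤⊤±)

  ≤ᴳ-total : Total _≤ᴳ_
  ≤ᴳ-total ⟨ x ⟩ ⟨ y ⟩ = map-⊎ ⟨⟩≤⟨⟩ ⟨⟩≤⟨⟩ (≤±-total total x y)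
  ≤ᴳ-total (α ⁻) (β ⁻) = map-⊎ ⁻≤ ⁻≤ (≤±-total total [ α ] [ β ])
  ≤ᴳ-total -∞ y        = inj₁ (≤ᴳ-minimum y)
  ≤ᴳ-total x -∞        = inj₂ (≤ᴳ-minimum x)
  ≤ᴳ-total +∞ y        = inj₂ (≤ᴳ-maximum y)
  ≤ᴳ-total x +∞        = inj₁ (≤ᴳ-maximum x)
  -- Totality on ℝ is too weak here: a tie must place `β ⁻` below `fin α`, so the order is decided.
  ≤ᴳ-total (fin α) (β ⁻) with β ≤? α
  ... | yes β≤α = inj₂ (⁻≤ ±NonStrict.[ β≤α ])
  ... | no  β≰α = inj₁ (⟨⟩≤⁻ ±Strict.[ ≰⇒> Eq.sym reflexive total β≰α ])
  ≤ᴳ-total (α ⁻) (fin β) with α ≤? β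
  ... | yes α≤β = inj₁ (⁻≤ ±NonStrict.[ α≤β ])
  ... | no  α≰β = inj₂ (⟨⟩≤⁻ ±Strict.[ ≰⇒> Eq.sym reflexive total α≰β ])

  ≈ᴳ-refl : ∀ {x} → x ≈ᴳ x
  ≈ᴳ-refl {⟨ _ ⟩} = ⟨ ≈±-refl Eq.refl ⟩
  ≈ᴳ-refl {_ ⁻}   = Eq.refl ⁻

  ≈ᴳ-sym : Symmetric _≈ᴳ_
  ≈ᴳ-sym ⟨ p ⟩ = ⟨ ≈±-sym Eq.sym p ⟩
  ≈ᴳ-sym (p ⁻) = Eq.sym p ⁻

  ≈ᴳ-trans : Transitive _≈ᴳ_
  ≈ᴳ-trans ⟨ p ⟩ ⟨ q ⟩ = ⟨ ≈±-trans Eq.trans p q ⟩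
  ≈ᴳ-trans (p ⁻) (q ⁻) = Eq.trans p q ⁻

  ≤ᴳ-isTotalOrder : IsTotalOrder _≈ᴳ_ _≤ᴳ_
  ≤ᴳ-isTotalOrder = record
    { isPartialOrder = record
      { isPreorder = record
        { isEquivalence = record { refl = ≈ᴳ-refl ; sym = ≈ᴳ-sym ; trans = ≈ᴳ-trans }
        ; reflexive     = ≤ᴳ-reflexive
        ; trans         = ≤ᴳ-trans
        }
      ; antisym    = ≤ᴳ-antisym
      }
    ; total          = ≤ᴳ-total
    }

  ≤ᴳ-totalOrder : TotalOrder c (c ⊔ ℓ₁) (c ⊔ ℓ₁ ⊔ ℓ₂)
  ≤ᴳ-totalOrder = record { isTotalOrder = ≤ᴳ-isTotalOrder }

  open TotalOrder ≤ᴳ-totalOrder using (totalPreorder)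

  -- Sums as suprema, minima as infima

  x≤y⇒x⊕y≈y : ∀ {x y} → x ≤ᴳ y → x ⊕ y ≈ᴳ y
  x≤y⇒x⊕y≈y {x} {y} x≤y with x ≤ᴳ? y
  ... | yes _   = ≈ᴳ-refl
  ... | no  x≰y = contradiction x≤y x≰y

  x≥y⇒x⊕y≈x : ∀ {x y} → y ≤ᴳ x → x ⊕ y ≈ᴳ x
  x≥y⇒x⊕y≈x {x} {y} y≤x with x ≤ᴳ? y
  -- The test picks `y` on a tie, which is then equal to `x`.
  ... | yes x≤y = ≤ᴳ-antisym y≤x x≤y
  ... | no  _   = ≈ᴳ-refl

  x≤y⇒x⊓y≈x : ∀ {x y} → x ≤ᴳ y → x ⊓ y ≈ᴳ x
  x≤y⇒x⊓y≈x {x} {y} x≤y with x ≤ᴳ? y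
  ... | yes _   = ≈ᴳ-refl
  ... | no  x≰y = contradiction x≤y x≰y

  x≥y⇒x⊓y≈y : ∀ {x y} → y ≤ᴳ x → x ⊓ y ≈ᴳ y
  x≥y⇒x⊓y≈y {x} {y} y≤x with x ≤ᴳ? y
  ... | yes x≤y = ≤ᴳ-antisym x≤y y≤x
  ... | no  _   = ≈ᴳ-refl

  ⊕-maxOperator : MaxOperator totalPreorder
  ⊕-maxOperator = record { x≤y⇒x⊔y≈y = x≤y⇒x⊕y≈y ; x≥y⇒x⊔y≈x = x≥y⇒x⊕y≈x }

  ⊓-minOperator : MinOperator totalPreorder
  ⊓-minOperator = record { x≤y⇒x⊓y≈x = x≤y⇒x⊓y≈x ; x≥y⇒x⊓y≈y = x≥y⇒x⊓y≈y }

  open MaxOp ⊕-maxOperator using (x≤x⊔y; x≤y⊔x; ⊔-lub)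
  open MinOp ⊓-minOperator using (x⊓y≤x; x⊓y≤y; ⊓-glb)

  x≤⨁x : ∀ {n} (x : Vector 𝔾 n) i → x i ≤ᴳ ⨁ x
  x≤⨁x x zero    = x≤x⊔y (x zero) _
  x≤⨁x x (suc i) = ≤ᴳ-trans (x≤⨁x (x ∘ suc) i) (x≤y⊔x (x zero) _)

  ⨁-lub : ∀ {n} {x : Vector 𝔾 n} {y} → (∀ i → x i ≤ᴳ y) → ⨁ x ≤ᴳ y
  ⨁-lub {ℕ.zero}  x≤y = ≤ᴳ-minimum _
  ⨁-lub {ℕ.suc n} x≤y = ⊔-lub (x≤y zero) (⨁-lub (x≤y ∘ suc))

  minimum≤x : ∀ {n} (x : Vector 𝔾 n) i → minimum x ≤ᴳ x i
  minimum≤x x zero    = x⊓y≤x (x zero) _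
  minimum≤x x (suc i) = ≤ᴳ-trans (x⊓y≤y (x zero) _) (minimum≤x (x ∘ suc) i)

  minimum-glb : ∀ {n} {x : Vector 𝔾 n} {y} → (∀ i → y ≤ᴳ x i) → y ≤ᴳ minimum x
  minimum-glb {ℕ.zero}  y≤x = ≤ᴳ-maximum _
  minimum-glb {ℕ.suc n} y≤x = ⊓-glb (y≤x zero) (minimum-glb (y≤x ∘ suc))

  -- Scalar residuation

  -- A product with a factor in ℝ⁻ is in ℝ⁻, so its comparison is never strict and the bound on `z`
  -- is the plain difference of moduli. Only for `x` real and `y` in ℝ⁻ does an unsigned `z` need
  -- strictness, which is why the residual is then in ℝ⁻.
  ⊗≤⇒≤/ : ∀ z x y → z ⊗ x ≤ᴳ y → z ≤ᴳ y / x
  ⊗≤⇒≤/ -∞      x       y       _ = ≤ᴳ-minimum (y / x)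
  -- The residual is `+∞`; `y` is split so that `_/_` reduces.
  ⊗≤⇒≤/ z       -∞      ⟨ _ ⟩   _ = ≤ᴳ-maximum z
  ⊗≤⇒≤/ z       -∞      (_ ⁻)   _ = ≤ᴳ-maximum z
  ⊗≤⇒≤/ z       +∞      +∞      _ = ≤ᴳ-maximum z
  ⊗≤⇒≤/ z       (fin _) +∞      _ = ≤ᴳ-maximum z
  ⊗≤⇒≤/ z       (_ ⁻)   +∞      _ = ≤ᴳ-maximum z
  ⊗≤⇒≤/ (fin _) (fin _) (fin _) (⟨⟩≤⟨⟩ ±NonStrict.[ p ]) = ⟨⟩≤⟨⟩ ±NonStrict.[ +≤⇒≤- p ]
  ⊗≤⇒≤/ (fin _) (fin _) (_ ⁻)   (⟨⟩≤⁻ ±Strict.[ p ])     = ⟨⟩≤⁻ ±Strict.[ +<⇒<- p ]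
  ⊗≤⇒≤/ (fin _) (_ ⁻)   (fin _) (⁻≤ ±NonStrict.[ p ])    = ⟨⟩≤⟨⟩ ±NonStrict.[ +≤⇒≤- p ]
  ⊗≤⇒≤/ (fin _) (_ ⁻)   (_ ⁻)   (⁻≤ ±NonStrict.[ p ])    = ⟨⟩≤⟨⟩ ±NonStrict.[ +≤⇒≤- p ]
  ⊗≤⇒≤/ (_ ⁻)   (fin _) (fin _) (⁻≤ ±NonStrict.[ p ])    = ⁻≤ ±NonStrict.[ +≤⇒≤- p ]
  ⊗≤⇒≤/ (_ ⁻)   (fin _) (_ ⁻)   (⁻≤ ±NonStrict.[ p ])    = ⁻≤ ±NonStrict.[ +≤⇒≤- p ]
  ⊗≤⇒≤/ (_ ⁻)   (_ ⁻)   (fin _) (⁻≤ ±NonStrict.[ p ])    = ⁻≤ ±NonStrict.[ +≤⇒≤- p ]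
  ⊗≤⇒≤/ (_ ⁻)   (_ ⁻)   (_ ⁻)   (⁻≤ ±NonStrict.[ p ])    = ⁻≤ ±NonStrict.[ +≤⇒≤- p ]
  -- From here on the product is `+∞` while `y` is not, so the hypothesis is absurd.
  ⊗≤⇒≤/ (fin _) +∞      ⟨ Supremum.[ _ ] ⟩ (⟨⟩≤⟨⟩ ())
  ⊗≤⇒≤/ (fin _) +∞      (_ ⁻)   (⟨⟩≤⁻ ())
  ⊗≤⇒≤/ (_ ⁻)   +∞      ⟨ Supremum.[ _ ] ⟩ (⟨⟩≤⟨⟩ ())
  ⊗≤⇒≤/ (_ ⁻)   +∞      (_ ⁻)   (⟨⟩≤⁻ ())
  ⊗≤⇒≤/ +∞      +∞      ⟨ Supremum.[ _ ] ⟩ (⟨⟩≤⟨⟩ ())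
  ⊗≤⇒≤/ +∞      +∞      (_ ⁻)   (⟨⟩≤⁻ ())
  ⊗≤⇒≤/ +∞      (fin _) ⟨ Supremum.[ _ ] ⟩ (⟨⟩≤⟨⟩ ())
  ⊗≤⇒≤/ +∞      (fin _) (_ ⁻)   (⟨⟩≤⁻ ())
  ⊗≤⇒≤/ +∞      (_ ⁻)   ⟨ Supremum.[ _ ] ⟩ (⟨⟩≤⟨⟩ ())
  ⊗≤⇒≤/ +∞      (_ ⁻)   (_ ⁻)   (⟨⟩≤⁻ ())

  -- For the cases where the residual is `-∞`: `z` must then be `-∞`, which absorbs every factor.
  ≤-∞⇒⊗≤ : ∀ {z} x {y} → z ≤ᴳ -∞ → z ⊗ x ≤ᴳ y
  ≤-∞⇒⊗≤ { -∞} _ _ = ≤ᴳ-minimum _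
  ≤-∞⇒⊗≤ {+∞}    _ (⟨⟩≤⟨⟩ ())
  ≤-∞⇒⊗≤ {fin _} _ (⟨⟩≤⟨⟩ (Supremum≤.[ () ]))
  ≤-∞⇒⊗≤ {_ ⁻}   _ (⁻≤ (Supremum≤.[ () ]))

  ≤/⇒⊗≤ : ∀ z x y → z ≤ᴳ y / x → z ⊗ x ≤ᴳ y
  ≤/⇒⊗≤ z       x       +∞      _ = ≤ᴳ-maximum (z ⊗ x)
  ≤/⇒⊗≤ -∞      x       y       _ = ≤ᴳ-minimum y
  ≤/⇒⊗≤ (fin _) -∞      y       _ = ≤ᴳ-minimum y
  ≤/⇒⊗≤ +∞      -∞      y       _ = ≤ᴳ-minimum y
  ≤/⇒⊗≤ (_ ⁻)   -∞      y       _ = ≤ᴳ-minimum y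
  ≤/⇒⊗≤ (fin _) (fin _) (fin _) (⟨⟩≤⟨⟩ ±NonStrict.[ p ]) = ⟨⟩≤⟨⟩ ±NonStrict.[ ≤-⇒+≤ p ]
  ≤/⇒⊗≤ (fin _) (fin _) (_ ⁻)   (⟨⟩≤⁻ ±Strict.[ p ])     = ⟨⟩≤⁻ ±Strict.[ <-⇒+< p ]
  ≤/⇒⊗≤ (fin _) (_ ⁻)   (fin _) (⟨⟩≤⟨⟩ ±NonStrict.[ p ]) = ⁻≤ ±NonStrict.[ ≤-⇒+≤ p ]
  ≤/⇒⊗≤ (fin _) (_ ⁻)   (_ ⁻)   (⟨⟩≤⟨⟩ ±NonStrict.[ p ]) = ⁻≤ ±NonStrict.[ ≤-⇒+≤ p ]
  ≤/⇒⊗≤ (_ ⁻)   (fin _) (fin _) (⁻≤ ±NonStrict.[ p ])    = ⁻≤ ±NonStrict.[ ≤-⇒+≤ p ]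
  ≤/⇒⊗≤ (_ ⁻)   (fin _) (_ ⁻)   (⁻≤ ±NonStrict.[ p ])    = ⁻≤ ±NonStrict.[ ≤-⇒+≤ p ]
  ≤/⇒⊗≤ (_ ⁻)   (_ ⁻)   (fin _) (⁻≤ ±NonStrict.[ p ])    = ⁻≤ ±NonStrict.[ ≤-⇒+≤ p ]
  ≤/⇒⊗≤ (_ ⁻)   (_ ⁻)   (_ ⁻)   (⁻≤ ±NonStrict.[ p ])    = ⁻≤ ±NonStrict.[ ≤-⇒+≤ p ]
  ≤/⇒⊗≤ z       +∞      ⟨ Supremum.[ _ ] ⟩ p = ≤-∞⇒⊗≤ +∞ p
  ≤/⇒⊗≤ z       +∞      (_ ⁻)   p = ≤-∞⇒⊗≤ +∞ p
  ≤/⇒⊗≤ z       (fin α) -∞      p = ≤-∞⇒⊗≤ (fin α) p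
  ≤/⇒⊗≤ z       (α ⁻)   -∞      p = ≤-∞⇒⊗≤ (α ⁻) p
  -- Now the residual has finite modulus and cannot bound `+∞`.
  ≤/⇒⊗≤ +∞      (fin _) (fin _) (⟨⟩≤⟨⟩ ())
  ≤/⇒⊗≤ +∞      (fin _) (_ ⁻)   (⟨⟩≤⁻ ())
  ≤/⇒⊗≤ +∞      (_ ⁻)   (fin _) (⟨⟩≤⟨⟩ ())
  ≤/⇒⊗≤ +∞      (_ ⁻)   (_ ⁻)   (⟨⟩≤⟨⟩ ())

  -- Residuation for row vectors

  -- Formal from the adjunction: z ≤ z′ ≤ (z′ ⊗ x) / x, and the division moves back.
  ⊗-monoˡ-≤ : ∀ x {z z′} → z ≤ᴳ z′ → z ⊗ x ≤ᴳ z′ ⊗ x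
  ⊗-monoˡ-≤ x z≤z′ =
    ≤/⇒⊗≤ _ x _ (≤ᴳ-trans z≤z′ (⊗≤⇒≤/ _ x _ (≤ᴳ-reflexive ≈ᴳ-refl)))

  ∙ᵣ-monoˡ-≤ : ∀ {p m} (M : Matrix 𝔾 p m) {w w′ : Vector 𝔾 p} →
               (∀ i → w i ≤ᴳ w′ i) → ∀ j → (w ∙ᵣ M) j ≤ᴳ (w′ ∙ᵣ M) j
  ∙ᵣ-monoˡ-≤ M w≤w′ j =
    ⨁-lub λ i → ≤ᴳ-trans (⊗-monoˡ-≤ (M i j) (w≤w′ i)) (x≤⨁x _ i)

  -- The i-th coefficient is at most the j-th quotient of row i, so each term of the j-th sum stays
  -- below `v j`.
  w*∙M≤v : ∀ {p m} (v : Vector 𝔾 m) (M : Matrix 𝔾 p m) j → (w* v M ∙ᵣ M) j ≤ᴳ v j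
  w*∙M≤v v M j = ⨁-lub λ i → ≤/⇒⊗≤ _ (M i j) (v j) (minimum≤x (λ k → v k / M i k) j)

  -- Each term of a sum is below the sum, so it can be residuated in every column.
  w*-greatest : ∀ {p m} (v : Vector 𝔾 m) (M : Matrix 𝔾 p m) {w : Vector 𝔾 p} →
                (∀ j → (w ∙ᵣ M) j ≤ᴳ v j) → ∀ i → w i ≤ᴳ w* v M i
  w*-greatest v M wM≤v i =
    minimum-glb λ j → ⊗≤⇒≤/ _ (M i j) (v j) (≤ᴳ-trans (x≤⨁x _ i) (wM≤v j))

  w*-solves : ∀ {p m} (v : Vector 𝔾 m) (M : Matrix 𝔾 p m) {w : Vector 𝔾 p} →
              v ≋ (w ∙ᵣ M) → v ≋ (w* v M ∙ᵣ M)
  w*-solves v M v≋wM j = ≤ᴳ-antisym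
    (≤ᴳ-trans (≤ᴳ-reflexive (v≋wM j))
              (∙ᵣ-monoˡ-≤ M (w*-greatest v M (≤ᴳ-reflexive ∘ ≈ᴳ-sym ∘ v≋wM)) j))
    (w*∙M≤v v M j)

proposition30 : ∀ {c ℓ₁ ℓ₂} (Real : Reals c ℓ₁ ℓ₂) → let open MaxPlus Real in
    ∀ {p n} (A : Matrix ℝmax p n) (B : Matrix 𝔾 p n) (𝐜 : Vector ℝmax p) (𝐝 : Vector 𝔾 p)
    (g : ℝmax) (h : 𝔾) (e : Vector ℝmax n) (f : Vector 𝔾 n) →
    let ineq = e ∙x⊕ g ≤ f ∙x⊕ h
        sys  = system A 𝐜 B 𝐝
        v    = row ineq
        R    = rows sys
    in
    h ≢ +∞ →
    ¬ (∀ j → lhs ineq j ≡ ⊥₋) →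
    (∀ i → ¬ (∀ j → R i j ≡ -∞)) →
    (ineq IsLinearCombinationOf sys) ⇔ (v ≋ (w* v R ∙ᵣ R))
proposition30 Real A B 𝐜 𝐝 g h e f _ _ _ =
  mk⇔ (λ (_ , v≋wR) → w*-solves Real (row (e ∙x⊕ g ≤ f ∙x⊕ h)) (rows (system A 𝐜 B 𝐝)) v≋wR)
      -- Unification finds the witness `w* v R`.
      (λ v≋w*R → _ , v≋w*R)
  where open MaxPlus Real
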